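{- For every integer $n \geq 3$, $$\gamma_{b,2}(P_5 \square C_n) = n + \begin{cases} 0 & \text{if } n \equiv 0 \pmod 2,\\ 1 & \text{if } n \equiv 1 \pmod 2.\end{cases}$$
   Context: For a graph $G$, a $2$-limited broadcast is a function $f: V(G) \to \{0,1,2\}$. A vertex $u$ hears the broadcast from $v$ if $f(v) > 0$ and $d(u,v) \leq f(v)$, where $d$ is the distance in $G$. The broadcast $f$ is dominating if every vertex of $G$ hears the broadcast from some vertex. The cost of $f$ is $\sum_{v \in V(G)} f(v)$. The $2$-limited broadcast domination number $\gamma_{b,2}(G)$ is the minimum cost of a $2$-limited dominating broadcast on $G$. $C_n$ denotes the cycle on $n$ vertices, $P_5$ the path on $5$ vertices, and $\square$ the Cartesian product of graphs. -}

module Defs where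

open import Data.Fin.Base using (Fin; toℕ)
open import Data.List.Base using (List; map; allFin; cartesianProduct)
open import Data.List.Membership.Propositional using (_∈_)
open import Data.List.Membership.Propositional.Properties
  using (∈-allFin; ∈-cartesianProduct⁺)
open import Data.List.Relation.Unary.Unique.Propositional using (Unique)
open import Data.List.Relation.Unary.Unique.Propositional.Properties
  using (allFin⁺; cartesianProduct⁺)
open import Data.Nat.Base using (ℕ; suc; _≤_; _<_; _≥_; s≤s)
open import Data.Nat.ListAction using (sum)
open import Data.Nat.Properties using (1+n≢n)
open import Data.Product.Base using (_×_; _,_; ∃-syntax)
open import Data.Sum.Base using (_⊎_; inj₁; inj₂)
open import Relation.Binary.Construct.Closure.Symmetric
  using (SymClosure; fwd; bwd; symmetric)
open import Relation.Binary.Definitions using (Symmetric)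
open import Relation.Binary.PropositionalEquality
  using (_≡_; refl; sym; trans; cong)
open import Relation.Nullary.Negation using (¬_)

-- Finite simple graphs.  The list `vertices` contains every vertex exactly
-- once, so that summing over it is summing over V(G).
record Graph : Set₁ where
  field
    Vertex   : Set
    vertices : List Vertex
    complete : ∀ v → v ∈ vertices
    unique   : Unique vertices
    Adj      : Vertex → Vertex → Set
    adj-sym  : Symmetric Adj
    adj-irr  : ∀ {v} → ¬ Adj v v

open Graph public using (Vertex; vertices)

path : ℕ → Graph
path n = record
  { Vertex   = Fin n
  ; vertices = allFin n
  ; complete = ∈-allFin
  ; unique   = allFin⁺ n
  ; Adj      = SymClosure Next
  ; adj-sym  = symmetric Next
  ; adj-irr  = λ { (fwd e) → 1+n≢n e ; (bwd e) → 1+n≢n e }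
  }
  where
  Next : Fin n → Fin n → Set
  Next i j = suc (toℕ i) ≡ toℕ j

cycle : (n : ℕ) → n ≥ 3 → Graph
cycle n n≥3 = record
  { Vertex   = Fin n
  ; vertices = allFin n
  ; complete = ∈-allFin
  ; unique   = allFin⁺ n
  ; Adj      = SymClosure Next
  ; adj-sym  = symmetric Next
  ; adj-irr  = λ { (fwd e) → irr e ; (bwd e) → irr e }
  }
  where
  -- The second alternative is the edge from the last vertex to the first.
  Next : Fin n → Fin n → Set
  Next i j = suc (toℕ i) ≡ toℕ j ⊎ (suc (toℕ i) ≡ n × toℕ j ≡ 0)

  1≢n : ∀ {m} → m ≥ 3 → ¬ 1 ≡ m
  1≢n (s≤s ()) refl

  irr : ∀ {i} → ¬ Next i i
  irr (inj₁ e)       = 1+n≢n e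
  irr (inj₂ (e , z)) = 1≢n n≥3 (trans (cong suc (sym z)) e)

infixr 7 _□_

_□_ : Graph → Graph → Graph
G □ H = record
  { Vertex   = G.Vertex × H.Vertex
  ; vertices = cartesianProduct G.vertices H.vertices
  ; complete = λ (u , v) → ∈-cartesianProduct⁺ (G.complete u) (H.complete v)
  ; unique   = cartesianProduct⁺ G.unique H.unique
  ; Adj      = Adj□
  ; adj-sym  = λ { (inj₁ (e , a)) → inj₁ (sym e , H.adj-sym a)
                 ; (inj₂ (e , a)) → inj₂ (sym e , G.adj-sym a) }
  ; adj-irr  = λ { (inj₁ (_ , a)) → H.adj-irr a
                 ; (inj₂ (_ , a)) → G.adj-irr a }
  }
  where
  module G = Graph G
  module H = Graph H

  Adj□ : G.Vertex × H.Vertex → G.Vertex × H.Vertex → Set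
  Adj□ (u , v) (u′ , v′) = (u ≡ u′ × H.Adj v v′) ⊎ (v ≡ v′ × G.Adj u u′)

module _ (G : Graph) where

  data Walk : Vertex G → Vertex G → ℕ → Set where
    []  : ∀ {u} → Walk u u 0
    _∷_ : ∀ {u v w k} → Graph.Adj G u v → Walk v w k → Walk u w (suc k)

  -- d(u,v) = k.  Distance is a relation because a disconnected graph has
  -- pairs of vertices at no finite distance.
  Distance : Vertex G → Vertex G → ℕ → Set
  Distance u v k = Walk u v k × (∀ m → Walk u v m → k ≤ m)

  -- k-limited broadcasts, i.e. functions V(G) → {0, …, k}.
  Broadcast : ℕ → Set
  Broadcast k = Vertex G → Fin (suc k)

  module _ {k : ℕ} where

    Hears : Broadcast k → Vertex G → Vertex G → Set
    Hears f u v = 0 < toℕ (f v) × ∃[ d ] (Distance u v d × d ≤ toℕ (f v))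

    Dominating : Broadcast k → Set
    Dominating f = ∀ u → ∃[ v ] Hears f u v

    cost : Broadcast k → ℕ
    cost f = sum (map (λ v → toℕ (f v)) (vertices G))

-- γ-b k [ G ]≐ m : the minimum cost of a k-limited dominating broadcast on G is m.
γ-b_[_]≐_ : ℕ → Graph → ℕ → Set
γ-b k [ G ]≐ m =
    (∃[ f ] (Dominating G {k} f × cost G f ≡ m))
  × (∀ (f : Broadcast G k) → Dominating G f → m ≤ cost G f)

{-# OPTIONS --safe #-}
-- Lower bound: reading the columns of a dominating broadcast around the cycle is a walk in a finite automaton.
-- A potential h on its states satisfies h(s) + 1 ≤ h(s′) + weight for every step s → s′, and summing once
-- around the cycle gives cost ≥ n.  If the cost is n, every step is tight.  A tight walk cannot avoid both
-- columns 10020 and 00200 for ever; consecutive occurrences of 10020, and of 00200 when 10020 is absent, are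
-- an even number of columns apart, so n is even.  Since h and tightness are monotone in what has been heard so
-- far, all this is verified on the finitely many maximal states.
--
-- Upper bound: repeat the columns 00200, 00000, 10001, 00000 after an exceptional block of length 3, 5 or 6
-- that fixes the residue of n modulo 4.
module Submission where

open import Defs
open import Algebra.Properties.CommutativeSemigroup using (interchange)
open import Data.Bool.Base as Bool using (Bool; true; false; T; _∧_; _∨_; not; if_then_else_)
import Data.Bool.Properties as Bool
open import Data.Empty using (⊥-elim)
open import Data.Fin.Base using (Fin; zero; suc; toℕ)
open import Data.Fin.Patterns using (0F; 1F; 2F; 3F; 4F)
import Data.Fin.Properties as Fin
open import Data.List.Base as List
  using (List; []; _∷_; _++_; map; filter; concat; concatMap; null; length; allFin; applyUpTo; cartesianProduct; cartesianProductWith)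
open import Data.List.Membership.Propositional using (_∈_; find; lose)
import Data.List.Membership.Propositional.Properties as ∈
import Data.List.Properties as List
open import Data.List.Relation.Unary.All as All using (All; []; _∷_)
open import Data.List.Relation.Unary.Any as Any using (Any; here; there; any?)
import Data.List.Relation.Unary.Any.Properties as Any
open import Data.Nat.Base
open import Data.Nat.DivMod
open import Data.Nat.ListAction using (sum)
open import Data.Nat.ListAction.Properties using (sum-++)
open import Data.Nat.Properties
open import Data.Product.Base using (_×_; _,_; ∃-syntax; proj₁; proj₂)
open import Data.Product.Properties using (≡-dec)
open import Data.Sum.Base using (_⊎_; inj₁; inj₂; [_,_]′)
open import Data.Vec.Base as Vec using (Vec; []; _∷_; lookup; tabulate; zipWith; replicate; head)
import Data.Vec.Properties as Vec
open import Data.Vec.Relation.Binary.Pointwise.Inductive as Pointwise using (Pointwise; []; _∷_)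
import Data.Vec.Relation.Unary.All as VecAll
import Data.Vec.Relation.Unary.All.Properties as VecAll
open import Function.Base using (_∘_; id; flip)
open import Function.Bundles using (Equivalence)
open import Relation.Binary.Construct.Closure.Symmetric using (SymClosure; fwd; bwd)
open import Relation.Binary.Definitions as Binary using (DecidableEquality)
open import Relation.Binary.PropositionalEquality
open import Relation.Nullary.Decidable
  using (Dec; does; proof; yes; no; map′; True; toWitness; isYes≗does; dec-true; ⌊_⌋; T?; ¬?; _×-dec_; _⊎-dec_; _→-dec_)
open import Relation.Nullary.Reflects using (Reflects; invert)
open import Relation.Unary using (Decidable)

-- Walks and costs in the cylinder

module Walks (G : Graph) where

  open Graph G using (Adj; adj-sym)

  infixr 5 _⁀_

  _⁀_ : ∀ {u v w k l} → Walk G u v k → Walk G v w l → Walk G u w (k + l)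
  []      ⁀ q = q
  (e ∷ p) ⁀ q = e ∷ (p ⁀ q)

  reverse : ∀ {u v k} → Walk G u v k → Walk G v u k
  reverse []                  = []
  reverse (_∷_ {k = k} e p) = subst (Walk G _ _) (+-comm k 1) (reverse p ⁀ (adj-sym e ∷ []))

  -- A walk of length at most 2 is already shortest unless its ends coincide or are adjacent, so two
  -- decidable tests yield an exact distance without a search for shortest walks.
  distance-≤2 : DecidableEquality (Vertex G) → Binary.Decidable Adj →
                ∀ {u v k} → k ≤ 2 → Walk G u v k → ∃[ d ] (Distance G u v d × d ≤ k)
  distance-≤2 _≟ᵥ_ adj? {u} {v} {k} k≤2 p with u ≟ᵥ v | adj? u v
  ... | yes refl | _     = 0 , ([] , λ _ _ → z≤n) , z≤n
  ... | no u≢v   | yes e = 1 , (e ∷ [] , λ _ → positive) , positive p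
    where
    positive : ∀ {m} → Walk G u v m → 1 ≤ m
    positive []      = ⊥-elim (u≢v refl)
    positive (_ ∷ _) = s≤s z≤n
  ... | no u≢v   | no ¬e = k , (p , λ m q → ≤-trans k≤2 (far q)) , ≤-refl
    where
    far : ∀ {m} → Walk G u v m → 2 ≤ m
    far []           = ⊥-elim (u≢v refl)
    far (e ∷ [])     = ⊥-elim (¬e e)
    far (_ ∷ _ ∷ _)  = s≤s (s≤s z≤n)

sum-map-+ : ∀ {A : Set} (f g : A → ℕ) xs → sum (map f xs) + sum (map g xs) ≡ sum (map (λ x → f x + g x) xs)
sum-map-+ f g []       = refl
sum-map-+ f g (x ∷ xs) = trans (interchange +-commutativeSemigroup (f x) _ (g x) _) (cong (f x + g x +_) (sum-map-+ f g xs))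

-- The product is enumerated row by row, whereas the cost is wanted column by column: an exchange of
-- summations.
sum-cartesianProduct : ∀ {A B : Set} (g : A × B → ℕ) xs ys →
  sum (map g (cartesianProduct xs ys)) ≡ sum (map (λ y → sum (map (λ x → g (x , y)) xs)) ys)
sum-cartesianProduct g []       ys = sym (zeros ys)
  where
  zeros : ∀ {B : Set} (ys : List B) → sum (map (λ _ → 0) ys) ≡ 0
  zeros []       = refl
  zeros (_ ∷ ys) = zeros ys
sum-cartesianProduct g (x ∷ xs) ys = begin
  sum (map g (map (x ,_) ys ++ cartesianProduct xs ys))
    ≡⟨ cong sum (List.map-++ g (map (x ,_) ys) _) ⟩
  sum (map g (map (x ,_) ys) ++ map g (cartesianProduct xs ys))
    ≡⟨ sum-++ (map g (map (x ,_) ys)) _ ⟩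
  sum (map g (map (x ,_) ys)) + sum (map g (cartesianProduct xs ys))
    ≡⟨ cong₂ _+_ (cong sum (sym (List.map-∘ ys))) (sum-cartesianProduct g xs ys) ⟩
  sum (map (λ y → g (x , y)) ys) + sum (map (λ y → sum (map (λ x → g (x , y)) xs)) ys)
    ≡⟨ sum-map-+ _ _ ys ⟩
  sum (map (λ y → g (x , y) + sum (map (λ x → g (x , y)) xs)) ys) ∎
  where open ≡-Reasoning

Column : Set
Column = Vec (Fin 3) 5

weight : Column → ℕ
weight c = Vec.sum (Vec.map toℕ c)

module Cylinder (n : ℕ) (n≥3 : n ≥ 3) where

  instance
    n≢0 : NonZero n
    n≢0 = >-nonZero (≤-trans (s≤s z≤n) n≥3)

  G : Graph
  G = path 5 □ cycle n n≥3

  open Graph G using (Adj)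
  open Walks G
  module P = Graph (path 5)
  module C = Graph (cycle n n≥3)

  toℕ-mod : ∀ m → toℕ (m mod n) ≡ m % n
  toℕ-mod m = Fin.toℕ-fromℕ< _

  mod-cong : ∀ {m m′} → m % n ≡ m′ % n → m mod n ≡ m′ mod n
  mod-cong {m} {m′} eq = Fin.toℕ-injective (trans (toℕ-mod m) (trans eq (sym (toℕ-mod m′))))

  toℕ-% : ∀ (j : Fin n) → toℕ j % n ≡ toℕ j
  toℕ-% j = m<n⇒m%n≡m (Fin.toℕ<n j)

  mod-toℕ : ∀ (j : Fin n) → toℕ j mod n ≡ j
  mod-toℕ j = Fin.toℕ-injective (trans (toℕ-mod (toℕ j)) (toℕ-% j))

  suc-% : ∀ m → suc (m % n) % n ≡ suc m % n
  suc-% m = begin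
    suc (m % n) % n           ≡⟨ %-distribˡ-+ 1 (m % n) n ⟩
    (1 % n + m % n % n) % n   ≡⟨ cong (λ x → (1 % n + x) % n) (m%n%n≡m%n m n) ⟩
    (1 % n + m % n) % n       ≡⟨ %-distribˡ-+ 1 m n ⟨
    suc m % n                 ∎
    where open ≡-Reasoning

  -- Adding `pred n` undoes the successor modulo `n`.
  suc-%-injective : ∀ {a b} → suc a % n ≡ suc b % n → a % n ≡ b % n
  suc-%-injective {a} {b} eq = trans (sym (back a)) (trans (cong (λ x → (x + pred n) % n) eq) (back b))
    where
    back : ∀ a → (suc a % n + pred n) % n ≡ a % n
    back a = begin
      (suc a % n + pred n) % n              ≡⟨ %-distribˡ-+ (suc a % n) (pred n) n ⟩
      (suc a % n % n + pred n % n) % n      ≡⟨ cong (λ x → (x + pred n % n) % n) (m%n%n≡m%n (suc a) n) ⟩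
      (suc a % n + pred n % n) % n          ≡⟨ %-distribˡ-+ (suc a) (pred n) n ⟨
      (suc a + pred n) % n                  ≡⟨ cong (_% n) (trans (sym (+-suc a (pred n))) (cong (a +_) (suc-pred n))) ⟩
      (a + n) % n                           ≡⟨ [m+n]%n≡m%n a n ⟩
      a % n                                 ∎
      where open ≡-Reasoning

  Next : Fin n → Fin n → Set
  Next i j = suc (toℕ i) ≡ toℕ j ⊎ (suc (toℕ i) ≡ n × toℕ j ≡ 0)

  next⇒ : ∀ {i j} → Next i j → suc (toℕ i) % n ≡ toℕ j
  next⇒ {j = j} (inj₁ e)       = trans (cong (_% n) e) (toℕ-% j)
  next⇒         (inj₂ (e , z)) = trans (cong (_% n) e) (trans (n%n≡0 n) (sym z))

  next-mod : ∀ m → Next (m mod n) (suc m mod n)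
  next-mod m with m≤n⇒m<n∨m≡n (m%n<n m n)
  ... | inj₁ lt = inj₁ (begin
    suc (toℕ (m mod n))   ≡⟨ cong suc (toℕ-mod m) ⟩
    suc (m % n)           ≡⟨ m<n⇒m%n≡m lt ⟨
    suc (m % n) % n       ≡⟨ suc-% m ⟩
    suc m % n             ≡⟨ toℕ-mod (suc m) ⟨
    toℕ (suc m mod n)     ∎)
    where open ≡-Reasoning
  ... | inj₂ eq = inj₂ (trans (cong suc (toℕ-mod m)) eq , (begin
    toℕ (suc m mod n)     ≡⟨ toℕ-mod (suc m) ⟩
    suc m % n             ≡⟨ suc-% m ⟨
    suc (m % n) % n       ≡⟨ cong (_% n) eq ⟩
    n % n                 ≡⟨ n%n≡0 n ⟩
    0                     ∎))
    where open ≡-Reasoning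

  -- Unrolls the cycle: columns are indexed by naturals read modulo `n`, which turns the wrap-around
  -- edge into an ordinary step. The bound `1 ≤ m` leaves room for a backward step.
  cycle-neighbour : ∀ {m j} → 1 ≤ m → C.Adj (m mod n) j → ∃[ m′ ] (j ≡ m′ mod n × ∣ m - m′ ∣ ≤ 1)
  cycle-neighbour {m} {j} _ (fwd e) = suc m , Fin.toℕ-injective (begin
    toℕ j                     ≡⟨ next⇒ e ⟨
    suc (toℕ (m mod n)) % n   ≡⟨ cong (λ x → suc x % n) (toℕ-mod m) ⟩
    suc (m % n) % n           ≡⟨ suc-% m ⟩
    suc m % n                 ≡⟨ toℕ-mod (suc m) ⟨
    toℕ (suc m mod n)         ∎) , ≤-reflexive (trans (cong ∣ m -_∣ (+-comm 1 m)) (∣m-m+n∣≡n m 1))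
    where open ≡-Reasoning
  cycle-neighbour {suc m} {j} _ (bwd e) = m , trans (sym (mod-toℕ j))
    (mod-cong (suc-%-injective (trans (next⇒ e) (toℕ-mod (suc m))))) ,
    ≤-reflexive (trans (∣-∣-comm (suc m) m) (trans (cong ∣ m -_∣ (+-comm 1 m)) (∣m-m+n∣≡n m 1)))

  path-neighbour : ∀ {r r′} → P.Adj r r′ → ∣ toℕ r - toℕ r′ ∣ ≤ 1
  path-neighbour {r} {r′} (fwd e) rewrite sym e =
    ≤-reflexive (trans (cong ∣ toℕ r -_∣ (+-comm 1 (toℕ r))) (∣m-m+n∣≡n (toℕ r) 1))
  path-neighbour {r} {r′} (bwd e) rewrite sym e =
    ≤-reflexive (trans (∣-∣-comm (suc (toℕ r′)) (toℕ r′)) (trans (cong ∣ toℕ r′ -_∣ (+-comm 1 (toℕ r′))) (∣m-m+n∣≡n (toℕ r′) 1)))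

  -- The hypothesis k ≤ m keeps the steps towards smaller columns inside ℕ.
  walk⇒near : ∀ {m r r′ j k} → k ≤ m → Walk G (r , m mod n) (r′ , j) k →
              ∃[ m′ ] (j ≡ m′ mod n × ∣ toℕ r - toℕ r′ ∣ + ∣ m - m′ ∣ ≤ k)
  walk⇒near {m} {r} k≤m [] = m , refl , ≤-reflexive (cong₂ _+_ (∣n-n∣≡0 (toℕ r)) (∣n-n∣≡0 m))
  walk⇒near {m} {r} {r′} (s≤s k≤m) (inj₁ (refl , a) ∷ p) with cycle-neighbour (s≤s z≤n) a
  ... | m₁ , refl , near with walk⇒near (s≤s⁻¹ (≤-trans (s≤s k≤m) m≤1+m₁)) p
    where
    m≤1+m₁ : m ≤ suc m₁
    m≤1+m₁ = ≤-trans (m≤n+∣m-n∣ m m₁) (≤-trans (+-monoʳ-≤ m₁ near) (≤-reflexive (+-comm m₁ 1)))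
  ... | m′ , eq , le = m′ , eq , (begin
    ∣ toℕ r - toℕ r′ ∣ + ∣ m - m′ ∣              ≤⟨ +-monoʳ-≤ ∣ toℕ r - toℕ r′ ∣ (∣-∣-triangle m m₁ m′) ⟩
    ∣ toℕ r - toℕ r′ ∣ + (∣ m - m₁ ∣ + ∣ m₁ - m′ ∣) ≤⟨ +-monoʳ-≤ ∣ toℕ r - toℕ r′ ∣ (+-monoˡ-≤ _ near) ⟩
    ∣ toℕ r - toℕ r′ ∣ + suc ∣ m₁ - m′ ∣           ≡⟨ +-suc _ _ ⟩
    suc (∣ toℕ r - toℕ r′ ∣ + ∣ m₁ - m′ ∣)         ≤⟨ s≤s le ⟩
    _ ∎)
    where open ≤-Reasoning
  walk⇒near {m} {r} {r′} k≤m (_∷_ {v = r₁ , _} (inj₂ (refl , a)) p) with walk⇒near (≤-trans (n≤1+n _) k≤m) p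
  ... | m′ , eq , le = m′ , eq , (begin
    ∣ toℕ r - toℕ r′ ∣ + ∣ m - m′ ∣                              ≤⟨ +-monoˡ-≤ _ (∣-∣-triangle (toℕ r) (toℕ r₁) (toℕ r′)) ⟩
    ∣ toℕ r - toℕ r₁ ∣ + ∣ toℕ r₁ - toℕ r′ ∣ + ∣ m - m′ ∣   ≤⟨ +-monoˡ-≤ _ (+-monoˡ-≤ _ (path-neighbour a)) ⟩
    suc (∣ toℕ r₁ - toℕ r′ ∣ + ∣ m - m′ ∣)                     ≤⟨ s≤s le ⟩
    _ ∎)
    where open ≤-Reasoning

  up : ∀ k {r r′ j} → toℕ r + k ≡ toℕ r′ → Walk G (r , j) (r′ , j) k
  up zero {r} {j = j} eq with Fin.toℕ-injective (trans (sym (+-identityʳ (toℕ r))) eq)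
  ... | refl = []
  up (suc k) {r} {r′} eq =
    inj₂ (refl , fwd (sym (Fin.toℕ-fromℕ< r+1<5))) ∷ up k (trans (cong (_+ k) (Fin.toℕ-fromℕ< r+1<5)) eq′)
    where
    eq′ : suc (toℕ r) + k ≡ toℕ r′
    eq′ = trans (sym (+-suc (toℕ r) k)) eq
    r+1<5 : suc (toℕ r) < 5
    r+1<5 = ≤-<-trans (m+n≤o⇒m≤o (suc (toℕ r)) (≤-reflexive eq′)) (Fin.toℕ<n r′)

  along : ∀ k m {r} → Walk G (r , m mod n) (r , (m + k) mod n) k
  along zero    m rewrite +-identityʳ m = []
  along (suc k) m rewrite +-suc m k     = inj₁ (refl , fwd (next-mod m)) ∷ along k (suc m)

  vertical : ∀ r r′ {j} → Walk G (r , j) (r′ , j) ∣ toℕ r - toℕ r′ ∣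
  vertical r r′ with ≤-total (toℕ r) (toℕ r′)
  ... | inj₁ le = up _ (trans (cong (toℕ r +_) (m≤n⇒∣m-n∣≡n∸m le)) (m+[n∸m]≡n le))
  ... | inj₂ ge = reverse (up _ (trans (cong (toℕ r′ +_) (m≤n⇒∣n-m∣≡n∸m ge)) (m+[n∸m]≡n ge)))

  horizontal : ∀ m m′ {r} → Walk G (r , m mod n) (r , m′ mod n) ∣ m - m′ ∣
  horizontal m m′ with ≤-total m m′
  ... | inj₁ le rewrite m≤n⇒∣m-n∣≡n∸m le =
    subst (λ x → Walk G _ (_ , x mod n) (m′ ∸ m)) (m+[n∸m]≡n le) (along (m′ ∸ m) m)
  ... | inj₂ ge rewrite m≤n⇒∣n-m∣≡n∸m ge =
    subst (λ x → Walk G (_ , x mod n) _ (m ∸ m′)) (m+[n∸m]≡n ge) (reverse (along (m ∸ m′) m′))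

  adj? : Binary.Decidable Adj
  adj? (r , j) (r′ , j′) =
    ((r Fin.≟ r′) ×-dec sym? (λ i j → (_ ≟ _) ⊎-dec ((_ ≟ _) ×-dec (_ ≟ _))) j j′) ⊎-dec
    ((j Fin.≟ j′) ×-dec sym? (λ _ _ → _ ≟ _) r r′)
    where
    sym? : ∀ {A : Set} {R : A → A → Set} → Binary.Decidable R → Binary.Decidable (SymClosure R)
    sym? R? x y = map′ [ fwd , bwd ]′ (λ { (fwd e) → inj₁ e ; (bwd e) → inj₂ e }) (R? x y ⊎-dec R? y x)

  -- On a short cycle the way round may be shorter than the unrolled walk, so `d` is only bounded by
  -- `k`.
  near⇒distance : ∀ m r m′ r′ {k} → k ≤ 2 → ∣ toℕ r - toℕ r′ ∣ + ∣ m - m′ ∣ ≤ k →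
                  ∃[ d ] (Distance G (r , m mod n) (r′ , m′ mod n) d × d ≤ k)
  near⇒distance m r m′ r′ k≤2 le
    with distance-≤2 (≡-dec Fin._≟_ Fin._≟_) adj? (≤-trans le k≤2) (vertical r r′ ⁀ horizontal m m′)
  ... | d , dist , d≤ = d , dist , ≤-trans d≤ le

  module _ (f : Broadcast G 2) where

    column : Fin n → Column
    column j = Vec.tabulate λ r → f (r , j)

    cost-columns : cost G f ≡ sum (List.tabulate (weight ∘ column))
    cost-columns = trans (sum-cartesianProduct (toℕ ∘ f) (allFin 5) (allFin n))
                         (cong sum (List.map-tabulate id (weight ∘ column)))

-- Coverage of a column by a window of five

Mask : Set
Mask = Vec Bool 5

-- Here `d` is the horizontal offset between the column `c` and the column whose row `r` is
-- listening.
Hit : ℕ → Column → Fin 5 → Set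
Hit d c r = ∃[ r′ ] (0 < toℕ (lookup c r′) × ∣ toℕ r - toℕ r′ ∣ + d ≤ toℕ (lookup c r′))

hit? : ∀ d c → Decidable (Hit d c)
hit? d c r = Fin.any? λ r′ → (0 <? toℕ (lookup c r′)) ×-dec (∣ toℕ r - toℕ r′ ∣ + d ≤? toℕ (lookup c r′))

reach : ℕ → Column → Mask
reach d c = tabulate λ r → does (hit? d c r)

infixl 6 _∪_
_∪_ : Mask → Mask → Mask
_∪_ = zipWith _∨_

Full : Mask → Set
Full = VecAll.All T

full? : Decidable Full
full? = VecAll.all? T?

infix 4 _⊑_ _≼_ _≼?_

_⊑_ : Mask → Mask → Set
_⊑_ = Pointwise Bool._≤_

∪-mono : ∀ {a b c d} → a ⊑ b → c ⊑ d → a ∪ c ⊑ b ∪ d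
∪-mono = Pointwise.zipWith-cong ∨-mono
  where
  ∨-mono : ∀ {a b c d} → a Bool.≤ b → c Bool.≤ d → a ∨ c Bool.≤ b ∨ d
  ∨-mono {b = true}  Bool.b≤b _ = Bool.b≤b
  ∨-mono {b = false} Bool.b≤b q = q
  ∨-mono {c = false} Bool.f≤t _ = Bool.f≤t
  ∨-mono {c = true}  Bool.f≤t _ = Bool.b≤b

⊑-refl : ∀ {a} → a ⊑ a
⊑-refl = Pointwise.refl Bool.≤-refl

full-mono : ∀ {k} {a b : Vec Bool k} → Pointwise Bool._≤_ a b → VecAll.All T a → VecAll.All T b
full-mono []              VecAll.[]       = VecAll.[]
full-mono (Bool.b≤b ∷ ps) (t VecAll.∷ ts) = t VecAll.∷ full-mono ps ts

-- Unions are grouped to the left, exactly as they accumulate in the automaton, so that coverage of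
-- a window and feasibility of a move agree definitionally.
⋃ : ∀ {k} → Vec Mask (suc k) → Mask
⋃ (a ∷ [])     = a
⋃ (a ∷ b ∷ as) = ⋃ (a ∪ b ∷ as)

-- The middle column is the listener; the five masks are what each column of the window lets it
-- hear.
reaches : Vec Column 5 → Vec Mask 5
reaches (a ∷ b ∷ c ∷ d ∷ e ∷ []) = reach 2 a ∷ reach 1 b ∷ reach 0 c ∷ reach 1 d ∷ reach 2 e ∷ []

coverage : Vec Column 5 → Mask
coverage cs = ⋃ (reaches cs)

window : (ℕ → Column) → ℕ → Vec Column 5
window C i = C i ∷ C (1 + i) ∷ C (2 + i) ∷ C (3 + i) ∷ C (4 + i) ∷ []

infix 4 _∋_
_∋_ : Mask → Fin 5 → Set
a ∋ r = T (lookup a r)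

∪⁺ : ∀ a b r → a ∋ r ⊎ b ∋ r → a ∪ b ∋ r
∪⁺ a b r p rewrite Vec.lookup-zipWith _∨_ r a b = Equivalence.from Bool.T-∨ p

∪⁻ : ∀ a b r → a ∪ b ∋ r → a ∋ r ⊎ b ∋ r
∪⁻ a b r p rewrite Vec.lookup-zipWith _∨_ r a b = Equivalence.to Bool.T-∨ p

⋃⁺ : ∀ {k} (as : Vec Mask (suc k)) r t → lookup as t ∋ r → ⋃ as ∋ r
⋃⁺ (a ∷ [])     r 0F            p = p
⋃⁺ (a ∷ b ∷ as) r 0F            p = ⋃⁺ (a ∪ b ∷ as) r 0F (∪⁺ a b r (inj₁ p))
⋃⁺ (a ∷ b ∷ as) r 1F            p = ⋃⁺ (a ∪ b ∷ as) r 0F (∪⁺ a b r (inj₂ p))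
⋃⁺ (a ∷ b ∷ as) r (suc (suc t)) p = ⋃⁺ (a ∪ b ∷ as) r (suc t) p

⋃⁻ : ∀ {k} (as : Vec Mask (suc k)) r → ⋃ as ∋ r → ∃[ t ] (lookup as t ∋ r)
⋃⁻ (a ∷ [])     r p = 0F , p
⋃⁻ (a ∷ b ∷ as) r p with ⋃⁻ (a ∪ b ∷ as) r p
... | 0F    , q = [ (0F ,_) , (1F ,_) ]′ (∪⁻ a b r q)
... | suc t , q = suc (suc t) , q

reach⁺ : ∀ d c r → Hit d c r → reach d c ∋ r
reach⁺ d c r hit rewrite Vec.lookup∘tabulate (λ r → does (hit? d c r)) r | dec-true (hit? d c r) hit = _

reach⁻ : ∀ d c r → reach d c ∋ r → Hit d c r
reach⁻ d c r p rewrite Vec.lookup∘tabulate (λ r → does (hit? d c r)) r =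
  toWitness (subst T (sym (isYes≗does (hit? d c r))) p)

hit-distance : ∀ d c r → Hit d c r → d ≤ 2
hit-distance d c r (r′ , _ , le) = ≤-trans (m+n≤o⇒n≤o _ le) (s≤s⁻¹ (Fin.toℕ<n (lookup c r′)))

-- Shifting the sequence reduces to the window at 0. Columns outside the window are more than 2 away
-- from its middle, which `hit-distance` excludes.
hit⇒covered : ∀ C i m r → Hit ∣ 2 + i - m ∣ (C m) r → coverage (window C i) ∋ r
hit⇒covered C zero 0 r hit = ⋃⁺ (reaches (window C 0)) r 0F (reach⁺ 2 (C 0) r hit)
hit⇒covered C zero 1 r hit = ⋃⁺ (reaches (window C 0)) r 1F (reach⁺ 1 (C 1) r hit)
hit⇒covered C zero 2 r hit = ⋃⁺ (reaches (window C 0)) r 2F (reach⁺ 0 (C 2) r hit)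
hit⇒covered C zero 3 r hit = ⋃⁺ (reaches (window C 0)) r 3F (reach⁺ 1 (C 3) r hit)
hit⇒covered C zero 4 r hit = ⋃⁺ (reaches (window C 0)) r 4F (reach⁺ 2 (C 4) r hit)
hit⇒covered C zero (suc (suc (suc (suc (suc m))))) r hit with hit-distance (3 + m) (C (5 + m)) r hit
... | s≤s (s≤s ())
hit⇒covered C (suc i) zero    r hit with hit-distance (3 + i) (C 0) r hit
... | s≤s (s≤s ())
hit⇒covered C (suc i) (suc m) r hit = hit⇒covered (C ∘ suc) i m r hit

covered⇒hit : ∀ C i r → coverage (window C i) ∋ r → ∃[ m ] Hit ∣ 2 + i - m ∣ (C m) r
covered⇒hit C zero r p with ⋃⁻ (reaches (window C 0)) r p
... | 0F , q = 0 , reach⁻ 2 (C 0) r q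
... | 1F , q = 1 , reach⁻ 1 (C 1) r q
... | 2F , q = 2 , reach⁻ 0 (C 2) r q
... | 3F , q = 3 , reach⁻ 1 (C 3) r q
... | 4F , q = 4 , reach⁻ 2 (C 4) r q
covered⇒hit C (suc i) r p with covered⇒hit (C ∘ suc) i r p
... | m , hit = suc m , hit

c₀₀₀₀₀ c₀₀₂₀₀ c₁₀₀₀₁ c₁₀₀₂₀ c₂₀₀₀₂ : Column
c₀₀₀₀₀ = 0F ∷ 0F ∷ 0F ∷ 0F ∷ 0F ∷ []
c₀₀₂₀₀ = 0F ∷ 0F ∷ 2F ∷ 0F ∷ 0F ∷ []
c₁₀₀₀₁ = 1F ∷ 0F ∷ 0F ∷ 0F ∷ 1F ∷ []
c₁₀₀₂₀ = 1F ∷ 0F ∷ 0F ∷ 2F ∷ 0F ∷ []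
c₂₀₀₀₂ = 2F ∷ 0F ∷ 0F ∷ 0F ∷ 2F ∷ []

-- The transfer automaton

odd : ℕ → Bool
odd zero    = false
odd (suc t) = not (odd t)

%2-cases : ∀ n → n % 2 ≡ 0 ⊎ n % 2 ≡ 1
%2-cases 0             = inj₁ refl
%2-cases 1             = inj₂ refl
%2-cases (suc (suc n)) = %2-cases n

odd-%2 : ∀ n → n % 2 ≡ 1 → odd n ≡ true
odd-%2 1             _  = refl
odd-%2 (suc (suc n)) eq rewrite odd-%2 n eq = refl

-- After reading columns up to i: the cells of columns i - 1, i, i + 1 and i + 2 that already hear a vertex.
State : Set
State = Vec Mask 4

_≼_ : State → State → Set
_≼_ = Pointwise _⊑_

_≼?_ : ∀ s t → Dec (s ≼ t)
_≼?_ = Pointwise.decidable (Pointwise.decidable Bool._≤?_)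

≼-trans : ∀ {s t u} → s ≼ t → t ≼ u → s ≼ u
≼-trans = Pointwise.trans (Pointwise.trans Bool.≤-trans)

-- A column, reduced to its weight and what it lets the columns at distance 0, 1, 2 hear.  The class is 2 for
-- 10020, 1 for 00200 and 0 otherwise.
record Move : Set where
  constructor move
  field
    charge   : ℕ
    r₀ r₁ r₂ : Mask
    class    : ℕ
open Move

-- The oldest tracked column is at distance 2 from the new one, so this is its last chance to be
-- heard completely.
Feasible : State → Move → Set
Feasible s m = Full (head s ∪ r₂ m)

step : State → Move → State
step (_ ∷ y ∷ z ∷ w ∷ []) m = y ∪ r₁ m ∷ z ∪ r₀ m ∷ w ∪ r₁ m ∷ r₂ m ∷ []

feasible-mono : ∀ {s t} m → s ≼ t → Feasible s m → Feasible t m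
feasible-mono m (p ∷ _) = full-mono (∪-mono p ⊑-refl)

step-mono : ∀ {s t} m → s ≼ t → step s m ≼ step t m
step-mono m (_ ∷ p ∷ q ∷ r ∷ []) =
  ∪-mono p ⊑-refl ∷ ∪-mono q ⊑-refl ∷ ∪-mono r ⊑-refl ∷ ⊑-refl ∷ []

-- An entry (k , t) asserts that every state below t has height at least k.
Entry : Set
Entry = ℕ × State

height : List Entry → State → ℕ
height []             s = 0
height ((k , t) ∷ es) s = if does (s ≼? t) then k ⊔ height es s else height es s

height-attained : ∀ es s → height es s ≡ 0 ⊎ Any (λ (k , t) → height es s ≡ k × s ≼ t) es
height-attained []             s = inj₁ refl
height-attained ((k , t) ∷ es) s with s ≼? t | height-attained es s
... | no _    | inj₁ h≡0 = inj₁ h≡0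
... | no _    | inj₂ any = inj₂ (there any)
... | yes s≼t | ih with ⊔-sel k (height es s) | ih
...   | inj₁ eq | _        = inj₂ (here (eq , s≼t))
...   | inj₂ eq | inj₁ h≡0 = inj₁ (trans eq h≡0)
...   | inj₂ eq | inj₂ any = inj₂ (there (Any.map (λ (e , p) → trans eq e , p) any))

-- A smaller state lies below every entry that a larger one lies below, so its maximum runs over at
-- least as many entries.
height-antitone : ∀ es {s t} → s ≼ t → height es t ≤ height es s
height-antitone []             s≼t = z≤n
height-antitone ((k , u) ∷ es) {s} {t} s≼t with s ≼? u | t ≼? u
... | yes _  | yes _  = ⊔-mono-≤ (≤-refl {k}) (height-antitone es s≼t)
... | yes _  | no _   = ≤-trans (height-antitone es s≼t) (m≤n⊔m k _)
... | no s⋠u | yes t≼u = ⊥-elim (s⋠u (≼-trans s≼t t≼u))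
... | no _   | no _   = height-antitone es s≼t

-- The potential and the search for tight walks

module Automaton (entries : List Entry) (moves : List Move) where

  h : State → ℕ
  h = height entries

  -- A move with charge above `k` satisfies the inequality by its charge alone, so only lighter
  -- moves are tested.
  Sound : Entry → Move → Set
  Sound (k , t) m = charge m ≤ k → Feasible t m → suc k ≤ h (step t m) + charge m

  Invariant : Set
  Invariant = All (λ e → All (Sound e) moves) entries

  invariant? : Dec Invariant
  invariant? = All.all? (λ (k , t) → All.all? (λ m →
    (charge m ≤? k) →-dec (full? (head t ∪ r₂ m) →-dec (suc k ≤? h (step t m) + charge m))) moves) entries

  -- The recorded number is the exact height of `s`, which may exceed that of the larger state `t`
  -- standing in for it.
  Covers : State → List Entry → Set
  Covers s = Any (λ (k , t) → h s ≡ k × s ≼ t)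

  -- A necessary condition for a tight move out of any state that `(k , t)` covers: both feasibility
  -- and the height bound pass from such a state up to `t`.
  Permitted : Entry → Move → Set
  Permitted (k , t) m = charge m ≤ suc k × Feasible t m × h (step t m) + charge m ≤ suc k

  permitted? : ∀ e → Decidable (Permitted e)
  permitted? (k , t) m = (charge m ≤? suc k) ×-dec (full? (head t ∪ r₂ m) ×-dec (h (step t m) + charge m ≤? suc k))

  advance : Entry → Move → Entry
  advance (k , t) m = suc k ∸ charge m , step t m

  dominated? : ∀ e → Decidable (λ e′ → proj₁ e′ ≡ proj₁ e × proj₂ e′ ≼ proj₂ e)
  dominated? (k , t) (l , u) = (l ≟ k) ×-dec (u ≼? t)

  -- Keeping only maximal states among those of equal height loses no covered state and keeps the
  -- search small.
  insert : Entry → List Entry → List Entry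
  insert e es = if ⌊ any? (flip dominated? e) es ⌋ then es else e ∷ filter (¬? ∘ dominated? e) es

  images : List Move → List Entry → List Entry
  images ms = List.foldr insert [] ∘ concatMap (λ e → map (advance e) (filter (permitted? e) ms))

  under exactly upTo : ℕ → List Move
  under   c = filter (λ m → class m <? c) moves
  exactly c = filter (λ m → class m ≟ c) moves
  upTo    c = filter (λ m → class m ≤? c) moves

  exhausted : ℕ → List Move → List Entry → Bool
  exhausted zero    ms es = null es
  exhausted (suc j) ms es = exhausted j ms (images ms es)

  -- The flag p is true after an odd number of moves since the last move from ms.  A return at the wrong parity is
  -- harmless when the state it leads to admits no two further moves.
  explore : ℕ → (us ms as : List Move) → Bool → List Entry → Bool
  explore zero    us ms as p es = null es
  explore (suc j) us ms as p es =
    (p ∨ null (images as (images as (images ms es)))) ∧ explore j us ms as (not p) (images us es)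

  -- The search starts just after a move of class `c` from any state, with higher classes assumed
  -- absent. Success also means that class `c` cannot be avoided for `j` further moves.
  returns : ℕ → ℕ → Bool
  returns j c = explore j (under c) (exactly c) (upTo c) false (images (exactly c) entries)

  module Potential (invariant : Invariant) (bottom : ∀ s → Any (λ (k , t) → k ≡ 0 × s ≼ t) entries) where

    covers-entries : ∀ s → Covers s entries
    covers-entries s with height-attained entries s
    ... | inj₂ any = any
    ... | inj₁ h≡0 = Any.map (λ (k≡0 , s≼t) → trans h≡0 (sym k≡0) , s≼t) (bottom s)

    -- The invariant holds at an entry attaining `h s` and passes down to `s`, because feasibility
    -- and `step` are monotone and `h` is antitone.
    step-height : ∀ {s m} → m ∈ moves → Feasible s m → suc (h s) ≤ h (step s m) + charge m
    step-height {s} {m} m∈ feasible with find (covers-entries s)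
    ... | (k , t) , e∈ , (h≡k , s≼t) with charge m ≤? k
    ...   | no c≰k  = ≤-trans (≤-trans (≤-reflexive (cong suc h≡k)) (≰⇒> c≰k)) (m≤n+m (charge m) _)
    ...   | yes c≤k = begin
      suc (h s)                 ≡⟨ cong suc h≡k ⟩
      suc k                     ≤⟨ All.lookup (All.lookup invariant e∈) m∈ c≤k (feasible-mono m s≼t feasible) ⟩
      h (step t m) + charge m   ≤⟨ +-monoˡ-≤ (charge m) (height-antitone entries (step-mono m s≼t)) ⟩
      h (step s m) + charge m   ∎
      where open ≤-Reasoning

    insert-covers : ∀ {s} e es → Covers s (e ∷ es) → Covers s (insert e es)
    insert-covers e es c with any? (flip dominated? e) es
    insert-covers e es (here (h≡ , s≼)) | yes d = Any.map (λ (k≡l , t≼u) → trans h≡ k≡l , ≼-trans s≼ t≼u) d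
    insert-covers e es (there c)        | yes d = c
    insert-covers e es (here p)         | no _  = here p
    insert-covers e es (there c)        | no _  with find c
    ... | e′ , e′∈ , (h≡ , s≼) with dominated? e e′
    ...   | yes (l≡k , u≼t) = here (trans h≡ l≡k , ≼-trans s≼ u≼t)
    ...   | no ¬d           = there (lose (∈.∈-filter⁺ (¬? ∘ dominated? e) e′∈ ¬d) (h≡ , s≼))

    prune-covers : ∀ {s es} → Covers s es → Covers s (List.foldr insert [] es)
    prune-covers {es = e ∷ es} (here p)  = insert-covers e (List.foldr insert [] es) (here p)
    prune-covers {es = e ∷ es} (there c) = insert-covers e (List.foldr insert [] es) (there (prune-covers c))

    -- Tightness determines the height after the move, and monotonicity lets the move pass the test
    -- at the covering entry.
    images-covers : ∀ {s m ms es} → m ∈ ms → Feasible s m → suc (h s) ≡ h (step s m) + charge m →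
                    Covers s es → Covers (step s m) (images ms es)
    images-covers {s} {m} {ms} m∈ feasible tight =
      prune-covers ∘ Any.concatMap⁺ (λ e → map (advance e) (filter (permitted? e) ms)) ∘ Any.map advance-covers
      where
      advance-covers : ∀ {e} → h s ≡ proj₁ e × s ≼ proj₂ e →
                       Covers (step s m) (map (advance e) (filter (permitted? e) ms))
      advance-covers {k , t} (refl , s≼t) =
        lose (∈.∈-map⁺ (advance (k , t)) (∈.∈-filter⁺ (permitted? (k , t)) m∈
               ( ≤-trans (m≤n+m (charge m) (h (step s m))) (≤-reflexive (sym tight))
               , feasible-mono m s≼t feasible
               , ≤-trans (+-monoˡ-≤ (charge m) (height-antitone entries (step-mono m s≼t))) (≤-reflexive (sym tight)))))
             (sym (trans (cong (_∸ charge m) tight) (m+n∸n≡m _ (charge m))) , step-mono m s≼t)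

    module TightWalk
      (s : ℕ → State) (m : ℕ → Move) (m∈ : ∀ i → m i ∈ moves)
      (feasible : ∀ i → Feasible (s i) (m i)) (next : ∀ i → s (suc i) ≡ step (s i) (m i))
      (tight : ∀ i → suc (h (s i)) ≡ h (s (suc i)) + charge (m i)) where

      walk-covers : ∀ i {ms es} → m i ∈ ms → Covers (s i) es → Covers (s (suc i)) (images ms es)
      walk-covers i {ms} {es} mi∈ c = subst (λ x → Covers x (images ms es)) (sym (next i))
        (images-covers mi∈ (feasible i) (trans (tight i) (cong (λ x → h x + charge (m i)) (next i))) c)

      not-null : ∀ {s es} → Covers s es → null es ≢ true
      not-null {es = _ ∷ _} _ ()

      -- An empty list covers no state, so the walk must make a move of positive class before the
      -- search dies out.
      exhausted⇒classed : ∀ j i {es} → exhausted j (under 1) es ≡ true → Covers (s i) es → ∃[ i′ ] (1 ≤ class (m i′))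
      exhausted⇒classed zero    i eq c = ⊥-elim (not-null c eq)
      exhausted⇒classed (suc j) i eq c with class (m i) <? 1
      ... | no ≮1  = i , ≮⇒≥ ≮1
      ... | yes <1 = exhausted⇒classed j (suc i) eq (walk-covers i (∈.∈-filter⁺ (λ m → class m <? 1) (m∈ i) <1) c)

      module _ {j c} (returns≡ : returns j c ≡ true) (class≤ : ∀ i → class (m i) ≤ c) where

        explored : ℕ → Bool → List Entry → Bool
        explored j = explore j (under c) (exactly c) (upTo c)

        exact∈ : ∀ {i} → class (m i) ≡ c → m i ∈ exactly c
        exact∈ {i} = ∈.∈-filter⁺ (λ m → class m ≟ c) (m∈ i)

        upTo∈ : ∀ i → m i ∈ upTo c
        upTo∈ i = ∈.∈-filter⁺ (λ m → class m ≤? c) (m∈ i) (class≤ i)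

        return-odd : ∀ k p {es} i → explored k p es ≡ true → Covers (s i) es → class (m i) ≡ c → p ≡ true
        return-odd zero    p     i eq cov _  = ⊥-elim (not-null cov eq)
        return-odd (suc k) true  i eq cov _  = refl
        -- The walk never stops: the return and the two moves after it lead to a covered state,
        -- where the search found none.
        return-odd (suc k) false i eq cov ≡c = ⊥-elim (not-null
          (walk-covers (2 + i) (upTo∈ (2 + i)) (walk-covers (suc i) (upTo∈ (suc i)) (walk-covers i (exact∈ ≡c) cov)))
          (Bool.∧-conicalˡ _ _ eq))

        -- Follows the walk by induction on `t`, keeping a list that covers the current state and
        -- from which the search still succeeds with flag `odd t`.
        tracked : ∀ {i} → class (m i) ≡ c → ∀ t →
                  ∃[ k ] ∃[ es ] (Covers (s (suc (t + i))) es × explored k (odd t) es ≡ true)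
        tracked {i} ≡c zero = j , _ , walk-covers i (exact∈ ≡c) (covers-entries (s i)) , returns≡
        tracked {i} ≡c (suc t) with tracked ≡c t
        ... | k , es , cov , eq with class (m (suc (t + i))) ≟ c
        -- A return forces `odd t` to be true, so the flag `false` of a restarted search agrees with
        -- `odd (suc t)`.
        ...   | yes ≡c′ rewrite return-odd k (odd t) _ eq cov ≡c′ = j , _ , walk-covers _ (exact∈ ≡c′) (covers-entries _) , returns≡
        tracked {i} ≡c (suc t) | zero  , es , cov , eq | no ≢c = ⊥-elim (not-null cov eq)
        tracked {i} ≡c (suc t) | suc k , es , cov , eq | no ≢c = k , _ ,
          walk-covers _ (∈.∈-filter⁺ (λ m → class m <? c) (m∈ _) (≤∧≢⇒< (class≤ _) ≢c)) cov ,
          Bool.∧-conicalʳ _ _ eq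

        -- Here `t` counts the moves strictly between the two occurrences, so odd `t` means an even
        -- distance.
        gap-odd : ∀ {i} t → class (m i) ≡ c → class (m (suc (t + i))) ≡ c → odd t ≡ true
        gap-odd t ≡c ≡c′ with tracked ≡c t
        ... | k , es , cov , eq = return-odd k (odd t) _ eq cov ≡c′

_≡ᶜ_ : Column → Column → Bool
c ≡ᶜ d = does (Vec.≡-dec Fin._≟_ c d)

toMove : Column → Move
toMove c = move (weight c) (reach 0 c) (reach 1 c) (reach 2 c)
  (if c ≡ᶜ c₁₀₀₂₀ then 2 else
   if c ≡ᶜ c₀₀₂₀₀ then 1 else 0)

-- Sums around the cycle

Σ< : (ℕ → ℕ) → ℕ → ℕ
Σ< F n = sum (applyUpTo F n)

Σ<-suc : ∀ F n → F n ≡ F 0 → Σ< (F ∘ suc) n ≡ Σ< F n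
Σ<-suc F n Fn≡F0 = +-cancelˡ-≡ (F 0) _ _ (begin
  Σ< F (suc n)                        ≡⟨ cong sum (List.applyUpTo-∷ʳ F n) ⟨
  sum (applyUpTo F n List.∷ʳ F n)     ≡⟨ sum-++ (applyUpTo F n) (F n ∷ []) ⟩
  Σ< F n + (F n + 0)                  ≡⟨ cong (Σ< F n +_) (+-identityʳ (F n)) ⟩
  Σ< F n + F n                        ≡⟨ +-comm (Σ< F n) (F n) ⟩
  F n + Σ< F n                        ≡⟨ cong (_+ Σ< F n) Fn≡F0 ⟩
  F 0 + Σ< F n                        ∎)
  where open ≡-Reasoning

tabulate-applyUpTo : ∀ {A : Set} (F : ℕ → A) n → List.tabulate {n = n} (F ∘ toℕ) ≡ applyUpTo F n
tabulate-applyUpTo F zero    = refl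
tabulate-applyUpTo F (suc n) = cong (F 0 ∷_) (tabulate-applyUpTo (F ∘ suc) n)

telescope : ∀ h w n → (∀ i → suc (h i) ≤ h (suc i) + w i) → n + h 0 ≤ h n + Σ< w n
telescope h w zero    _  = m≤m+n (h 0) 0
telescope h w (suc n) le = begin
  suc n + h 0                           ≡⟨ +-suc n (h 0) ⟨
  n + suc (h 0)                         ≤⟨ +-monoʳ-≤ n (le 0) ⟩
  n + (h 1 + w 0)                       ≡⟨ +-assoc n (h 1) (w 0) ⟨
  n + h 1 + w 0                         ≤⟨ +-monoˡ-≤ (w 0) (telescope (h ∘ suc) (w ∘ suc) n (le ∘ suc)) ⟩
  h (suc n) + Σ< (w ∘ suc) n + w 0      ≡⟨ +-assoc (h (suc n)) _ _ ⟩
  h (suc n) + (Σ< (w ∘ suc) n + w 0)    ≡⟨ cong (h (suc n) +_) (+-comm _ (w 0)) ⟩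
  h (suc n) + Σ< w (suc n)              ∎
  where open ≤-Reasoning

periodic-bound : ∀ h w n → h n ≡ h 0 → (∀ i → suc (h i) ≤ h (suc i) + w i) → n ≤ Σ< w n
periodic-bound h w n per le =
  +-cancelˡ-≤ (h 0) n _ (≤-trans (≤-reflexive (+-comm (h 0) n)) (≤-trans (telescope h w n le) (≤-reflexive (cong (_+ Σ< w n) per))))

-- Telescoping over the other `n` steps uses up the whole sum, which leaves no slack for the first
-- one.
periodic-tight₀ : ∀ h w n → h (suc n) ≡ h 0 → (∀ i → suc (h i) ≤ h (suc i) + w i) →
                  Σ< w (suc n) ≡ suc n → suc (h 0) ≡ h 1 + w 0
periodic-tight₀ h w n per le Σ≡ = ≤-antisym (le 0) (+-cancelˡ-≤ n _ _ (begin
  n + (h 1 + w 0)                       ≡⟨ +-assoc n (h 1) (w 0) ⟨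
  n + h 1 + w 0                         ≤⟨ +-monoˡ-≤ (w 0) (telescope (h ∘ suc) (w ∘ suc) n (le ∘ suc)) ⟩
  h (suc n) + Σ< (w ∘ suc) n + w 0      ≡⟨ +-assoc (h (suc n)) _ _ ⟩
  h (suc n) + (Σ< (w ∘ suc) n + w 0)    ≡⟨ cong₂ _+_ per (trans (+-comm _ (w 0)) Σ≡) ⟩
  h 0 + suc n                           ≡⟨ +-comm (h 0) (suc n) ⟩
  suc n + h 0                           ≡⟨ +-suc n (h 0) ⟨
  n + suc (h 0)                         ∎))
  where open ≤-Reasoning

-- Rotating the sequence makes any given step the first; periodicity preserves the sum.
periodic-tight : ∀ h w n → (∀ i → h (i + suc n) ≡ h i) → (∀ i → w (i + suc n) ≡ w i) →
                 (∀ i → suc (h i) ≤ h (suc i) + w i) → Σ< w (suc n) ≡ suc n →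
                 ∀ i → suc (h i) ≡ h (suc i) + w i
periodic-tight h w n hper wper le Σ≡ zero    = periodic-tight₀ h w n (hper 0) le Σ≡
periodic-tight h w n hper wper le Σ≡ (suc i) =
  periodic-tight (h ∘ suc) (w ∘ suc) n (hper ∘ suc) (wper ∘ suc) (le ∘ suc) (trans (Σ<-suc w (suc n) (wper 0)) Σ≡) i

class-≤2 : ∀ c → class (toMove c) ≤ 2
class-≤2 c = bound (c ≡ᶜ c₁₀₀₂₀) (c ≡ᶜ c₀₀₂₀₀)
  where
  bound : ∀ b b′ → (if b then 2 else if b′ then 1 else 0) ≤ 2
  bound true  _     = ≤-refl
  bound false true  = s≤s z≤n
  bound false false = z≤n

true-max : ∀ {k} (v : Vec Bool k) → Pointwise Bool._≤_ v (Vec.replicate k true)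
true-max []      = []
true-max (b ∷ v) = Bool.≤-maximum b ∷ true-max v

-- Strengths are at most 2, so the last four columns determine the state. Hence states inherit the
-- period of the columns and no initial state has to be chosen.
stateAt : (a b c d : Column) → State
stateAt a b c d =
  reach 2 a ∪ reach 1 b ∪ reach 0 c ∪ reach 1 d ∷
  reach 2 b ∪ reach 1 c ∪ reach 0 d ∷
  reach 2 c ∪ reach 1 d ∷
  reach 2 d ∷ []

stateAt-cong : ∀ {a b c d a′ b′ c′ d′} → a ≡ a′ → b ≡ b′ → c ≡ c′ → d ≡ d′ → stateAt a b c d ≡ stateAt a′ b′ c′ d′
stateAt-cong refl refl refl refl = refl

-- The lower bound from a certificate

module Certificate (entries : List Entry) (moves : List Move)
  (complete : ∀ c → toMove c ∈ moves) (bottom : ∀ s → Any (λ (k , t) → k ≡ 0 × s ≼ t) entries)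
  (invariant : Automaton.Invariant entries moves)
  (returns₂ : Automaton.returns entries moves 10 2 ≡ true)
  (returns₁ : Automaton.returns entries moves 20 1 ≡ true)
  (exhausted₀ : Automaton.exhausted entries moves 22 (Automaton.under entries moves 1) entries ≡ true) where

  open Automaton entries moves
  open Potential invariant bottom

  module CoveredSequence (n : ℕ) .{{_ : NonZero n}} (C : ℕ → Column)
    (C-cong : ∀ {i j} → i % n ≡ j % n → C i ≡ C j) (covered : ∀ i → Full (coverage (window C i))) where

    s : ℕ → State
    s i = stateAt (C i) (C (1 + i)) (C (2 + i)) (C (3 + i))

    m : ℕ → Move
    m i = toMove (C (4 + i))

    w : ℕ → ℕ
    w = weight ∘ C

    C-periodic : ∀ i → C (i + n) ≡ C i
    C-periodic i = C-cong ([m+n]%n≡m%n i n)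

    s-periodic : ∀ i → s (i + n) ≡ s i
    s-periodic i = stateAt-cong (C-periodic i) (C-periodic (1 + i)) (C-periodic (2 + i)) (C-periodic (3 + i))

    m∈ : ∀ i → m i ∈ moves
    m∈ i = complete (C (4 + i))

    descent : ∀ i → suc (h (s i)) ≤ h (s (suc i)) + w (4 + i)
    descent i = step-height (m∈ i) (covered i)

    -- Move `i` reads column `4 + i`, so the telescoped weights are those of the columns rotated by
    -- four places.
    Σ-shift : Σ< (λ i → w (4 + i)) n ≡ Σ< w n
    Σ-shift = trans (shift (λ i → w (3 + i)) (w-periodic 3)) (trans (shift (λ i → w (2 + i)) (w-periodic 2))
             (trans (shift (λ i → w (1 + i)) (w-periodic 1)) (shift w (w-periodic 0))))
      where
      w-periodic : ∀ i → w (i + n) ≡ w i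
      w-periodic i = cong weight (C-periodic i)
      shift : ∀ F → F n ≡ F 0 → Σ< (F ∘ suc) n ≡ Σ< F n
      shift F = Σ<-suc F n

    length≤weight : n ≤ Σ< w n
    length≤weight = subst (n ≤_) Σ-shift (periodic-bound (h ∘ s) (λ i → w (4 + i)) n (cong h (s-periodic 0)) descent)

  module OptimalSequence (n : ℕ) (C : ℕ → Column)
    (C-cong : ∀ {i j} → i % suc n ≡ j % suc n → C i ≡ C j) (covered : ∀ i → Full (coverage (window C i)))
    (optimal : Σ< (weight ∘ C) (suc n) ≡ suc n) where

    open CoveredSequence (suc n) C C-cong covered

    tight : ∀ i → suc (h (s i)) ≡ h (s (suc i)) + w (4 + i)
    tight = periodic-tight (h ∘ s) (λ i → w (4 + i)) n (λ i → cong h (s-periodic i))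
              (λ i → cong weight (C-periodic (4 + i))) descent (trans Σ-shift optimal)

    open TightWalk s m m∈ covered (λ _ → refl) tight

    classAt : ℕ → ℕ
    classAt i = class (m i)

    m-cong : ∀ {i j} → i % suc n ≡ j % suc n → classAt i ≡ classAt j
    m-cong {i} {j} eq = cong (class ∘ toMove) (C-cong (begin
      (4 + i) % suc n                             ≡⟨ %-distribˡ-+ 4 i (suc n) ⟩
      (4 % suc n + i % suc n) % suc n             ≡⟨ cong (λ x → (4 % suc n + x) % suc n) eq ⟩
      (4 % suc n + j % suc n) % suc n             ≡⟨ %-distribˡ-+ 4 j (suc n) ⟨
      (4 + j) % suc n                             ∎))
      where open ≡-Reasoning

    recurs : ∀ {i c} → classAt i ≡ c → classAt (suc (n + i)) ≡ c
    recurs {i} ≡c = trans (m-cong (trans (cong (_% suc n) (+-comm (suc n) i)) ([m+n]%n≡m%n i (suc n)))) ≡c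

    -- The period is `suc n`: an occurrence and its translate by one period have `n` moves between
    -- them. Class 2 is used if it occurs; otherwise class 1 must occur.
    predecessor-odd : odd n ≡ true
    predecessor-odd with anyUpTo? (λ i → classAt i ≟ 2) (suc n)
    ... | yes (i , _ , ≡2) = gap-odd {10} {2} returns₂ (λ i → class-≤2 (C (4 + i))) n ≡2 (recurs ≡2)
    ... | no ¬2 = gap-odd {20} {1} returns₁ ≤1 n ≡1 (recurs ≡1)
      where
      ≤1 : ∀ i → classAt i ≤ 1
      ≤1 i = s≤s⁻¹ (≤∧≢⇒< (class-≤2 (C (4 + i)))
        (λ ≡2 → ¬2 (i % suc n , m%n<n i (suc n) , trans (m-cong (m%n%n≡m%n i (suc n))) ≡2)))
      classed : ∃[ i ] (1 ≤ classAt i)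
      classed = exhausted⇒classed 22 0 exhausted₀ (covers-entries (s 0))
      ≡1 : classAt (classed .proj₁) ≡ 1
      ≡1 = ≤-antisym (≤1 _) (classed .proj₂)

  weight-bound : ∀ n .{{_ : NonZero n}} (C : ℕ → Column) → (∀ {i j} → i % n ≡ j % n → C i ≡ C j) →
                 (∀ i → Full (coverage (window C i))) → n + n % 2 ≤ Σ< (weight ∘ C) n
  weight-bound (suc n) C C-cong covered = [ even , odd′ ]′ (%2-cases (suc n))
    where
    length≤ : suc n ≤ Σ< (weight ∘ C) (suc n)
    length≤ = CoveredSequence.length≤weight (suc n) C C-cong covered

    even : suc n % 2 ≡ 0 → suc n + suc n % 2 ≤ Σ< (weight ∘ C) (suc n)
    even n%2≡0 = ≤-trans (≤-reflexive (trans (cong (suc n +_) n%2≡0) (+-identityʳ (suc n)))) length≤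

    suboptimal : suc n % 2 ≡ 1 → suc n ≢ Σ< (weight ∘ C) (suc n)
    suboptimal n%2≡1 eq = false≢true (trans
      (sym (cong not (OptimalSequence.predecessor-odd n C C-cong covered (sym eq)))) (odd-%2 (suc n) n%2≡1))
      where
      false≢true : false ≢ true
      false≢true ()

    odd′ : suc n % 2 ≡ 1 → suc n + suc n % 2 ≤ Σ< (weight ∘ C) (suc n)
    odd′ n%2≡1 = ≤-trans (≤-reflexive (trans (cong (suc n +_) n%2≡1) (+-comm (suc n) 1)))
                         (≤∧≢⇒< length≤ (suboptimal n%2≡1))

-- The upper bound

module CylinderCoverage (n : ℕ) (n≥3 : n ≥ 3) (f : Broadcast (path 5 □ cycle n n≥3) 2) where

  open Cylinder n n≥3

  C : ℕ → Column
  C i = column f (i mod n)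

  C-cong : ∀ {i j} → i % n ≡ j % n → C i ≡ C j
  C-cong eq = cong (column f) (mod-cong eq)

  lookup-C : ∀ m r → lookup (C m) r ≡ f (r , m mod n)
  lookup-C m r = Vec.lookup∘tabulate (λ r → f (r , m mod n)) r

  dominating⇒covered : Dominating G f → ∀ i → Full (coverage (window C i))
  dominating⇒covered dom i = VecAll.lookup⁻ at
    where
    at : ∀ r → coverage (window C i) ∋ r
    at r with dom (r , (2 + i) mod n)
    ... | (r′ , j) , 0<f , d , (walk , _) , d≤f
      -- The walk has length at most 2, hence at most `2 + i`, so its unrolling stays among the
      -- naturals.
      with walk⇒near {2 + i} (≤-trans (≤-trans d≤f (s≤s⁻¹ (Fin.toℕ<n (f (r′ , j))))) (m≤m+n 2 i)) walk
    ...   | m , refl , near = hit⇒covered C i m r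
      ( r′ , subst (λ x → 0 < toℕ x) (sym (lookup-C m r′)) 0<f
      , ≤-trans near (subst (λ x → d ≤ toℕ x) (sym (lookup-C m r′)) d≤f))

  covered⇒dominating : (∀ i → Full (coverage (window C i))) → Dominating G f
  covered⇒dominating covered (r , j) = subst (λ j → ∃[ v ] Hears G f (r , j) v) 2+i≡j heard
    where
    i : ℕ
    -- Congruent to `j` minus 2, which puts `j` in the middle of window `i`.
    i = toℕ j + (n ∸ 2)

    2+i≡j : (2 + i) mod n ≡ j
    2+i≡j = trans (mod-cong (begin
      (2 + (toℕ j + (n ∸ 2))) % n    ≡⟨ cong (_% n) (+-comm 2 _) ⟩
      (toℕ j + (n ∸ 2) + 2) % n      ≡⟨ cong (_% n) (+-assoc (toℕ j) (n ∸ 2) 2) ⟩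
      (toℕ j + (n ∸ 2 + 2)) % n      ≡⟨ cong (λ x → (toℕ j + x) % n) (m∸n+n≡m (≤-trans (n≤1+n 2) n≥3)) ⟩
      (toℕ j + n) % n                ≡⟨ [m+n]%n≡m%n (toℕ j) n ⟩
      toℕ j % n                      ∎)) (mod-toℕ j)
      where open ≡-Reasoning

    heard : ∃[ v ] Hears G f (r , (2 + i) mod n) v
    heard with covered⇒hit C i r (VecAll.lookup⁺ (covered i) r)
    ... | m , r′ , 0<c , near rewrite lookup-C m r′ =
      (r′ , m mod n) , 0<c , near⇒distance (2 + i) r m r′ (s≤s⁻¹ (Fin.toℕ<n (f (r′ , m mod n)))) near

  cost≡Σ : cost G f ≡ Σ< (weight ∘ C) n
  cost≡Σ = trans (cost-columns f) (cong sum (trans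
    (List.tabulate-cong (cong (weight ∘ column f) ∘ sym ∘ mod-toℕ))
    (tabulate-applyUpTo (weight ∘ C) n)))

-- Closed runs and the broadcasts they define

infix 4 _⟶[_]_

-- Each column appended to the history of four completes a covered window. A run that returns to its
-- initial history can be repeated and so describes a cyclic arrangement.
data _⟶[_]_ : Vec Column 4 → List Column → Vec Column 4 → Set where
  done : ∀ {h} → h ⟶[ [] ] h
  _∷_  : ∀ {a b c d e es h} → Full (coverage (a ∷ b ∷ c ∷ d ∷ e ∷ [])) → b ∷ c ∷ d ∷ e ∷ [] ⟶[ es ] h →
         a ∷ b ∷ c ∷ d ∷ [] ⟶[ e ∷ es ] h

_⟫_ : ∀ {h h′ h″ es es′} → h ⟶[ es ] h′ → h′ ⟶[ es′ ] h″ → h ⟶[ es ++ es′ ] h″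
done    ⟫ q = q
(c ∷ p) ⟫ q = c ∷ (p ⟫ q)

iterate : ∀ {h es} k → h ⟶[ es ] h → h ⟶[ concat (List.replicate k es) ] h
iterate zero    p = done
iterate (suc k) p = p ⟫ iterate k p

nth : List Column → ℕ → Column
nth []       _       = Vec.replicate 5 0F
nth (c ∷ cs) zero    = c
nth (c ∷ cs) (suc i) = nth cs i

-- Only windows lying within the appended columns are read off; the first four checks still involve
-- the initial history.
run⇒covered : ∀ {h es h′} → h ⟶[ es ] h′ → ∀ i → 4 + i < length es → Full (coverage (window (nth es) i))
run⇒covered (_ ∷ _ ∷ _ ∷ _ ∷ c ∷ _) zero    _       = c
run⇒covered (_ ∷ p)                 (suc i) (s≤s l) = run⇒covered p i l
run⇒covered (_ ∷ done) zero (s≤s ())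
run⇒covered (_ ∷ _ ∷ done) zero (s≤s (s≤s ()))
run⇒covered (_ ∷ _ ∷ _ ∷ done) zero (s≤s (s≤s (s≤s ())))
run⇒covered (_ ∷ _ ∷ _ ∷ _ ∷ done) zero (s≤s (s≤s (s≤s (s≤s ()))))

nth-++ˡ : ∀ es es′ {i} → i < length es → nth (es ++ es′) i ≡ nth es i
nth-++ˡ (e ∷ es) es′ {zero}  _       = refl
nth-++ˡ (e ∷ es) es′ {suc i} (s≤s l) = nth-++ˡ es es′ l

nth-++ʳ : ∀ es es′ i → nth (es ++ es′) (length es + i) ≡ nth es′ i
nth-++ʳ []       es′ i = refl
nth-++ʳ (e ∷ es) es′ i = nth-++ʳ es es′ i

nth-iterate : ∀ es .{{_ : NonZero (length es)}} k i → i < k * length es →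
              nth (concat (List.replicate k es)) i ≡ nth es (i % length es)
nth-iterate es (suc k) i i< with i <? length es
... | yes i<l = trans (nth-++ˡ es _ i<l) (cong (nth es) (sym (m<n⇒m%n≡m i<l)))
... | no i≮l  = begin
  nth (es ++ rest) i                     ≡⟨ cong (nth (es ++ rest)) (m+[n∸m]≡n (≮⇒≥ i≮l)) ⟨
  nth (es ++ rest) (length es + i′)      ≡⟨ nth-++ʳ es rest i′ ⟩
  nth rest i′                            ≡⟨ nth-iterate es k i′ i′< ⟩
  nth es (i′ % length es)                ≡⟨ cong (nth es) ([m+n]%n≡m%n i′ (length es)) ⟨
  nth es ((i′ + length es) % length es)  ≡⟨ cong (λ x → nth es (x % length es)) (m∸n+n≡m (≮⇒≥ i≮l)) ⟩
  nth es (i % length es)                 ∎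
  where
  open ≡-Reasoning
  rest = concat (List.replicate k es)
  i′ = i ∸ length es
  i′< : i′ < k * length es
  i′< = +-cancelˡ-< (length es) _ _ (subst (_< suc k * length es) (sym (m+[n∸m]≡n (≮⇒≥ i≮l))) i<)

length-iterate : ∀ (es : List Column) k → length (concat (List.replicate k es)) ≡ k * length es
length-iterate es zero    = refl
length-iterate es (suc k) = trans (List.length-++ es) (cong (length es +_) (length-iterate es k))

total : List Column → ℕ
total = sum ∘ map weight

tabulate-nth : ∀ es → List.tabulate {n = length es} (weight ∘ nth es ∘ toℕ) ≡ map weight es
tabulate-nth []       = refl
tabulate-nth (e ∷ es) = cong (weight e ∷_) (tabulate-nth es)

module Realise (es : List Column) (n≥3 : length es ≥ 3) {h} (run : h ⟶[ es ] h) where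

  open Cylinder (length es) n≥3

  f : Broadcast G 2
  f (r , j) = lookup (nth es (toℕ j)) r

  open CylinderCoverage (length es) n≥3 f

  column≡ : ∀ j → column f j ≡ nth es (toℕ j)
  column≡ j = Vec.tabulate∘lookup (nth es (toℕ j))

  C≡nth : ∀ i → C i ≡ nth es (i % length es)
  C≡nth i = trans (column≡ (i mod length es)) (cong (nth es) (toℕ-mod i))

  covered : ∀ i → Full (coverage (window C i))
  covered i = subst (Full ∘ coverage) agree
    -- The block is nonempty, so `5 + i` copies are long enough to contain window `i`.
    (run⇒covered (iterate (5 + i) run) i (≤-trans far (≤-reflexive (sym (length-iterate es (5 + i))))))
    where
    far : 5 + i ≤ (5 + i) * length es
    far = m≤m*n (5 + i) (length es)
    at : ∀ t → t < 5 → nth (concat (List.replicate (5 + i) es)) (t + i) ≡ C (t + i)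
    at t t<5 = trans (nth-iterate es (5 + i) (t + i) (≤-trans (+-monoˡ-< i t<5) far)) (sym (C≡nth (t + i)))
    agree : window (nth (concat (List.replicate (5 + i) es))) i ≡ window C i
    agree = cong₂ _∷_ (at 0 (s≤s z≤n)) (cong₂ _∷_ (at 1 (s≤s (s≤s z≤n))) (cong₂ _∷_ (at 2 (s≤s (s≤s (s≤s z≤n))))
            (cong₂ _∷_ (at 3 (s≤s (s≤s (s≤s (s≤s z≤n))))) (cong (_∷ []) (at 4 ≤-refl)))))

  realised : ∃[ f ] (Dominating G {2} f × cost G f ≡ total es)
  realised = f , covered⇒dominating covered ,
    trans (cost-columns f) (cong sum (trans (List.tabulate-cong (cong weight ∘ column≡)) (tabulate-nth es)))

next : ∀ {a b c d e es h} {full : True (full? (coverage (a ∷ b ∷ c ∷ d ∷ e ∷ [])))} →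
       b ∷ c ∷ d ∷ e ∷ [] ⟶[ es ] h → a ∷ b ∷ c ∷ d ∷ [] ⟶[ e ∷ es ] h
next {full = full} p = toWitness full ∷ p

-- Blocks for the residues modulo 4

period₄ : List Column
period₄ = c₀₀₂₀₀ ∷ c₀₀₀₀₀ ∷ c₁₀₀₀₁ ∷ c₀₀₀₀₀ ∷ []

history₄ : Vec Column 4
history₄ = c₀₀₂₀₀ ∷ c₀₀₀₀₀ ∷ c₁₀₀₀₁ ∷ c₀₀₀₀₀ ∷ []

period-run : history₄ ⟶[ period₄ ] history₄
period-run = next (next (next (next done)))

-- The block must serve in two ways: `closed` lets it fill a whole cycle, and `extensible` lets
-- further periods follow it.
record Tiling (n e : ℕ) : Set where
  field
    block      : List Column
    length≡    : length block ≡ n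
    total≡     : total block ≡ e
    {history}  : Vec Column 4
    closed     : history ⟶[ block ] history
    extensible : history₄ ⟶[ block ++ period₄ ] history₄

open Tiling

extend : ∀ {n e} → Tiling n e → Tiling (4 + n) (4 + e)
extend t .block      = t .block ++ period₄
extend t .length≡    = trans (List.length-++ (t .block)) (trans (+-comm _ 4) (cong (4 +_) (t .length≡)))
extend t .total≡     = trans (cong sum (List.map-++ weight (t .block) period₄))
                         (trans (sum-++ (map weight (t .block)) _) (trans (+-comm _ 4) (cong (4 +_) (t .total≡))))
extend t .history    = history₄
extend t .closed     = t .extensible
extend t .extensible = t .extensible ⟫ period-run

-- One block per residue; appending a period adds 4 to both length and cost and keeps the parity.
tilings : ∀ k → Tiling (3 + k) (3 + k + (3 + k) % 2)
tilings 0 = record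
  { block = c₀₀₂₀₀ ∷ c₀₀₀₀₀ ∷ c₁₀₀₀₁ ∷ [] ; length≡ = refl ; total≡ = refl
  -- The four columns that precede the block in its periodic repetition; having only three columns,
  -- it wraps around.
  ; history = c₁₀₀₀₁ ∷ c₀₀₂₀₀ ∷ c₀₀₀₀₀ ∷ c₁₀₀₀₁ ∷ []
  ; closed = next (next (next done))
  ; extensible = next (next (next (next (next (next (next done)))))) }
tilings 1 = record
  { block = period₄ ; length≡ = refl ; total≡ = refl ; closed = period-run ; extensible = period-run ⟫ period-run }
tilings 2 = record
  { block = c₀₀₂₀₀ ∷ c₀₀₀₀₀ ∷ c₀₀₀₀₀ ∷ c₂₀₀₀₂ ∷ c₀₀₀₀₀ ∷ [] ; length≡ = refl ; total≡ = refl
  ; history = c₀₀₀₀₀ ∷ c₀₀₀₀₀ ∷ c₂₀₀₀₂ ∷ c₀₀₀₀₀ ∷ []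
  ; closed = next (next (next (next (next done))))
  ; extensible = next (next (next (next (next (next (next (next (next done)))))))) }
tilings 3 = record
  { block = c₀₀₂₀₀ ∷ c₀₀₀₀₀ ∷ c₀₀₀₀₀ ∷ c₂₀₀₀₂ ∷ c₀₀₀₀₀ ∷ c₀₀₀₀₀ ∷ [] ; length≡ = refl ; total≡ = refl
  ; history = c₀₀₀₀₀ ∷ c₂₀₀₀₂ ∷ c₀₀₀₀₀ ∷ c₀₀₀₀₀ ∷ []
  ; closed = next (next (next (next (next (next done)))))
  ; extensible = next (next (next (next (next (next (next (next (next (next done))))))))) }
tilings (suc (suc (suc (suc k)))) = extend (tilings k)

upper-bound : ∀ n (n≥3 : n ≥ 3) → ∃[ f ] (Dominating (path 5 □ cycle n n≥3) {2} f × cost (path 5 □ cycle n n≥3) f ≡ n + n % 2)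
upper-bound n n≥3 = go n n≥3 (subst (λ n → Tiling n (n + n % 2)) (m+[n∸m]≡n n≥3) (tilings (n ∸ 3)))
  where
  go : ∀ n n≥3 {e} → Tiling n e → ∃[ f ] (Dominating (path 5 □ cycle n n≥3) {2} f × cost (path 5 □ cycle n n≥3) f ≡ e)
  go n n≥3 record { block = es ; length≡ = refl ; total≡ = refl ; closed = run } = Realise.realised es n≥3 run

-- The certificate

-- Masks in binary, least significant bit for row 0.
state : ℕ → ℕ → ℕ → ℕ → State
state a b c d = mask a ∷ mask b ∷ mask c ∷ mask d ∷ []
  where
  bits : ∀ w → ℕ → Vec Bool w
  bits zero    k = []
  bits (suc w) k = (k % 2 ≡ᵇ 1) ∷ bits w (k / 2)

  mask : ℕ → Mask
  mask = bits 5

-- For k ≥ 1, the maximal states reachable from the top state by reading columns whose total weight is k less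
-- than their number.
entries : List Entry
entries =
  (0 , state 31 31 31 31) ∷ (4 , state 0 0 0 0) ∷
  (3 , state 1 3 1 0) ∷ (3 , state 2 7 2 0) ∷ (3 , state 3 1 0 0) ∷
  (3 , state 4 14 4 0) ∷ (3 , state 7 2 0 0) ∷ (3 , state 8 28 8 0) ∷
  (3 , state 14 4 0 0) ∷ (3 , state 16 24 16 0) ∷ (3 , state 24 16 0 0) ∷
  (3 , state 28 8 0 0) ∷ (3 , state 31 0 0 0) ∷ (2 , state 3 7 3 1) ∷
  (2 , state 7 15 7 2) ∷ (2 , state 9 31 9 0) ∷ (2 , state 11 29 8 0) ∷
  (2 , state 14 31 14 4) ∷ (2 , state 15 7 1 0) ∷ (2 , state 15 30 8 0) ∷
  (2 , state 17 27 17 0) ∷ (2 , state 18 31 18 0) ∷ (2 , state 19 25 16 0) ∷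
  (2 , state 23 26 16 0) ∷ (2 , state 24 28 24 16) ∷ (2 , state 25 19 1 0) ∷
  (2 , state 26 23 2 0) ∷ (2 , state 28 30 28 8) ∷ (2 , state 29 11 1 0) ∷
  (2 , state 30 15 2 0) ∷ (2 , state 30 28 16 0) ∷ (2 , state 31 3 1 0) ∷
  (2 , state 31 7 2 0) ∷ (2 , state 31 14 4 0) ∷ (2 , state 31 24 16 0) ∷
  (2 , state 31 28 8 0) ∷ (2 , state 31 31 0 0) ∷ (1 , state 7 15 7 1) ∷
  (1 , state 11 31 11 1) ∷ (1 , state 15 31 15 2) ∷ (1 , state 15 31 15 4) ∷
  (1 , state 19 31 19 1) ∷ (1 , state 23 31 23 2) ∷ (1 , state 25 31 25 16) ∷
  (1 , state 26 31 26 16) ∷ (1 , state 28 30 28 16) ∷ (1 , state 29 31 29 8) ∷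
  (1 , state 30 31 30 4) ∷ (1 , state 30 31 30 8) ∷ (1 , state 31 15 3 1) ∷
  (1 , state 31 23 3 1) ∷ (1 , state 31 29 24 16) ∷ (1 , state 31 30 24 16) ∷
  (1 , state 31 31 7 2) ∷ (1 , state 31 31 14 4) ∷ (1 , state 31 31 28 8) ∷
  (1 , state 31 31 31 0) ∷
  []

columns : ∀ n → List (Vec (Fin 3) n)
columns zero    = [] ∷ []
columns (suc n) = cartesianProductWith _∷_ (allFin 3) (columns n)

columns-complete : ∀ {n} (c : Vec (Fin 3) n) → c ∈ columns n
columns-complete []      = here refl
columns-complete (x ∷ c) = ∈.∈-cartesianProductWith⁺ _∷_ (∈.∈-allFin x) (columns-complete c)

moves : List Move
moves = map toMove (columns 5)

entries-bottom : ∀ s → Any (λ (k , t) → k ≡ 0 × s ≼ t) entries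
entries-bottom (a ∷ b ∷ c ∷ d ∷ []) = here (refl , true-max a ∷ true-max b ∷ true-max c ∷ true-max d ∷ [])

-- Only the boolean of the decision is evaluated; the proof is recovered from it.
does⇒ : ∀ {A : Set} (a? : Dec A) → does a? ≡ true → A
does⇒ a? eq = invert (subst (Reflects _) eq (proof a?))

invariant : Automaton.Invariant entries moves
invariant = does⇒ (Automaton.invariant? entries moves) refl

-- On a tight walk, 10020 recurs within ten moves.
returns-c₁₀₀₂₀ : Automaton.returns entries moves 10 2 ≡ true
returns-c₁₀₀₂₀ = refl

-- On a tight walk without 10020, the column 00200 recurs within twenty moves.
returns-c₀₀₂₀₀ : Automaton.returns entries moves 20 1 ≡ true
returns-c₀₀₂₀₀ = refl

-- A tight walk using neither column has fewer than 22 moves.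
unclassed-exhausted : Automaton.exhausted entries moves 22 (Automaton.under entries moves 1) entries ≡ true
unclassed-exhausted = refl

open Certificate entries moves (∈.∈-map⁺ toMove ∘ columns-complete) entries-bottom
  invariant returns-c₁₀₀₂₀ returns-c₀₀₂₀₀ unclassed-exhausted

lower-bound : ∀ n (n≥3 : n ≥ 3) f → Dominating (path 5 □ cycle n n≥3) {2} f → n + n % 2 ≤ cost (path 5 □ cycle n n≥3) f
lower-bound n n≥3 f dominating = subst (n + n % 2 ≤_) (sym cost≡Σ) (weight-bound n C C-cong (dominating⇒covered dominating))
  where
  open Cylinder n n≥3 using (n≢0)
  open CylinderCoverage n n≥3 f

theorem4p11 : ∀ (n : ℕ) (n≥3 : n ≥ 3) →
    (n % 2 ≡ 0 → γ-b 2 [ path 5 □ cycle n n≥3 ]≐ (n + 0)) ×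
    (n % 2 ≡ 1 → γ-b 2 [ path 5 □ cycle n n≥3 ]≐ (n + 1))
theorem4p11 n n≥3 = minimum , minimum
  where
  minimum : ∀ {e} → n % 2 ≡ e → γ-b 2 [ path 5 □ cycle n n≥3 ]≐ (n + e)
  minimum refl = upper-bound n n≥3 , lower-bound n n≥3
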